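{- Let $\mathcal{L}$ be a finite relational language. If $U$ is an ultraextensive $\mathcal{L}$-structure, then every countable substructure $C\subseteq U$ can be extended to a countable ultraextensive substructure $D\subseteq U$ (that is, there is a countable substructure $D$ with $C\subseteq D\subseteq U$ such that $D$ is ultraextensive).
   Context: Basic notions. Substructures are induced substructures; $D$ is an extension of $C$ if $C$ is a substructure of $D$. HL-extensions. A partial isomorphism of an $\mathcal{L}$-structure $C$ is an isomorphism between two finite substructures of $C$. $\mathcal{P}_C$ denotes the set of partial isomorphisms $p$ of $C$ that are not restrictions of the identity map $1_C$. If $C_1\subseteq C_2$ then $\mathcal{P}_{C_1}\subseteq\mathcal{P}_{C_2}$. An HL-extension of $C$ is a pair $(D,\phi)$ where $D$ is an extension of $C$ and $\phi:\mathcal{P}_C\to\mathrm{Aut}(D)$ is such that $\phi(p)$ extends $p$ for all $p\in\mathcal{P}_C$; it is assumed throughout that $\phi(p^{ -1})=\phi(p)^{ -1}$. It is finite if $D$ is finite. It is minimal if for every $b\in D\setminus C$ there are $p_1,\dots,p_n\in\mathcal{P}_C$ and $a\in C$ with $b=\phi(p_1)\cdots\phi(p_n)(a)$. Coherence. Let $C_1\subseteq C_2$ and let $(D_i,\phi_i)$ be an HL-extension of $C_i$, $i=1,2$. They are coherent if (i) $D_2$ extends $D_1$; (ii) $\phi_2(p)$ extends $\phi_1(p)$ for all $p\in\mathcal{P}_{C_1}$; (iii) with $K_i=\langle\phi_i(\mathcal{P}_{C_i})\rangle\le\mathrm{Aut}(D_i)$, the map $\phi_1(p)\mapsto\phi_2(p)$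 ($p\in\mathcal{P}_{C_1}$) has a unique extension to an injective group homomorphism $K_1\to K_2$. Ultraextensive. An $\mathcal{L}$-structure $U$ is ultraextensive if (i) $U$ is ultrahomogeneous, i.e. there is $\phi$ such that $(U,\phi)$ is an HL-extension of $U$; (ii) every finite substructure $C\subseteq U$ has a finite HL-extension $(D,\phi)$ with $D\subseteq U$; (iii) if $C_1\subseteq C_2\subseteq U$ are finite and $(D_1,\phi_1)$ is a finite minimal HL-extension of $C_1$ with $D_1\subseteq U$, then there is a finite minimal HL-extension $(D_2,\phi_2)$ of $C_2$ with $D_2\subseteq U$ such that $(D_1,\phi_1)$ and $(D_2,\phi_2)$ are coherent. -}

module Defs where

open import Level using (Level; _⊔_) renaming (suc to lsuc)
open import Algebra.Bundles using (Group)
open import Algebra.Morphism.Structures using (module GroupMorphisms)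
open import Data.Fin using (Fin)
open import Data.List using (List; foldr)
open import Data.List.Membership.Propositional using (_∈_)
open import Data.Nat using (ℕ)
open import Data.Product using (Σ; ∃; ∃!; _×_; _,_; proj₁; proj₂)
open import Data.Vec using (Vec; map)
open import Data.Vec.Properties using (map-cong; map-∘)
open import Function using (_∘_)
open import Function.Bundles using (Func; Injection; Inverse; _⇔_; mk⇔; Equivalence)
import Function.Construct.Composition as Comp
import Function.Construct.Identity as Id
import Function.Construct.Symmetry as Symm
open import Relation.Binary.Bundles using (Setoid)
import Relation.Binary.Construct.On as On
open import Relation.Binary.PropositionalEquality
  using (_≡_; refl; sym; trans; cong; subst; setoid)
open import Relation.Nullary using (¬_)
open import Relation.Unary using (Pred; _⊆_)

module _ {c ℓ} (G : Group c ℓ) where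

  private module G = Group G

  data Generated {p} (X : Pred G.Carrier p) : Pred G.Carrier (c ⊔ ℓ ⊔ p) where
    gen  : ∀ {g} → X g → Generated X g
    unit : Generated X G.ε
    mul  : ∀ {g h} → Generated X g → Generated X h → Generated X (g G.∙ h)
    inv  : ∀ {g} → Generated X g → Generated X (g G.⁻¹)
    resp : ∀ {g h} → g G.≈ h → Generated X g → Generated X h

  generatedSubgroup : ∀ {p} → Pred G.Carrier p → Group (c ⊔ ℓ ⊔ p) ℓ
  generatedSubgroup X = record
    { Carrier = Σ G.Carrier (Generated X)
    ; _≈_     = λ g h → proj₁ g G.≈ proj₁ h
    ; _∙_     = λ (g , g∈) (h , h∈) → g G.∙ h , mul g∈ h∈
    ; ε       = G.ε , unit
    ; _⁻¹     = λ (g , g∈) → g G.⁻¹ , inv g∈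
    ; isGroup = record
      { isMonoid = record
        { isSemigroup = record
          { isMagma = record
            { isEquivalence = On.isEquivalence proj₁ G.isEquivalence
            ; ∙-cong        = G.∙-cong
            }
          ; assoc = λ x y z → G.assoc (proj₁ x) (proj₁ y) (proj₁ z)
          }
        ; identity = (λ x → G.identityˡ (proj₁ x)) , (λ x → G.identityʳ (proj₁ x))
        }
      ; inverse = (λ x → G.inverseˡ (proj₁ x)) , (λ x → G.inverseʳ (proj₁ x))
      ; ⁻¹-cong = G.⁻¹-cong
      }
    }

record Language : Set where
  field
    symbols : ℕ
    arity   : Fin symbols → ℕ

record Structure (L : Language) (ℓ : Level) : Set (lsuc ℓ) where
  open Language L
  field
    Carrier : Set ℓ
    rel     : (R : Fin symbols) → Vec Carrier (arity R) → Set ℓ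

-- All structures below are presented as induced substructures of an ambient
-- structure M (M itself being the one on the everywhere true predicate). Then
-- "D is an extension of C" is C ⊆ D, and 𝒫 C₁ ⊆ 𝒫 C₂ when C₁ ⊆ C₂. None of
-- the notions defined for a substructure X depends on the part of M outside X.
module _ {ℓ} {L : Language} (M : Structure L ℓ) where

  open Language L
  open Structure M

  Substructure : Set (lsuc ℓ)
  Substructure = Pred Carrier ℓ

  -- The underlying set of X: membership proofs are disregarded.
  Elements : Substructure → Setoid ℓ ℓ
  Elements X = On.setoid {B = Σ Carrier X} (setoid Carrier) proj₁

  -- A finite substructure is given by a list of its elements; repetitions and
  -- the order are immaterial.
  ⟪_⟫ : List Carrier → Substructure
  ⟪ xs ⟫ x = x ∈ xs

  Countable : Substructure → Set ℓ
  Countable X = Injection (Elements X) (setoid ℕ)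

  record Iso (X Y : Substructure) : Set ℓ where
    field
      bijection : Inverse (Elements X) (Elements Y)
    open Inverse bijection public
    field
      preserves : ∀ R (v : Vec (Σ Carrier X) (arity R)) →
                  rel R (map proj₁ v) ⇔ rel R (map (proj₁ ∘ to) v)

  idIso : ∀ X → Iso X X
  idIso X = record
    { bijection = Id.inverse (Elements X)
    ; preserves = λ R v → mk⇔ (λ r → r) (λ r → r)
    }

  symIso : ∀ {X Y} → Iso X Y → Iso Y X
  symIso {X} {Y} f = record
    { bijection = Symm.inverse bijection
    ; preserves = λ R v →
        let e = preserves R (map from v)
            p = sym (map-∘ proj₁ from v)
            q = trans (sym (map-∘ (proj₁ ∘ to) from v))
                      (map-cong (λ y → strictlyInverseˡ y) v)
        in mk⇔ (λ r → subst (rel R) p (Equivalence.from e (subst (rel R) (sym q) r)))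
               (λ r → subst (rel R) q (Equivalence.to e (subst (rel R) (sym p) r)))
    }
    where open Iso f

  infixr 9 _∘ᴵ_
  _∘ᴵ_ : ∀ {X Y Z} → Iso Y Z → Iso X Y → Iso X Z
  g ∘ᴵ f = record
    { bijection = Comp.inverse f.bijection g.bijection
    ; preserves = λ R v →
        let e = f.preserves R v
            h = g.preserves R (map f.to v)
            p = sym (map-∘ proj₁ f.to v)
            q = sym (map-∘ (proj₁ ∘ g.to) f.to v)
        in mk⇔ (λ r → subst (rel R) q (Equivalence.to h (subst (rel R) (sym p) (Equivalence.to e r))))
               (λ r → Equivalence.from e (subst (rel R) p (Equivalence.from h (subst (rel R) (sym q) r))))
    }
    where module f = Iso f
          module g = Iso g

  -- The automorphism group, multiplied by composition: (g ∙ f) x = g (f x).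
  Aut : Substructure → Group ℓ ℓ
  Aut X = record
    { Carrier = Iso X X
    ; _≈_     = λ f g → ∀ x → proj₁ (to f x) ≡ proj₁ (to g x)
    ; _∙_     = _∘ᴵ_
    ; ε       = idIso X
    ; _⁻¹     = symIso
    ; isGroup = record
      { isMonoid = record
        { isSemigroup = record
          { isMagma = record
            { isEquivalence = record
              { refl  = λ x → refl
              ; sym   = λ p x → sym (p x)
              ; trans = λ p q x → trans (p x) (q x)
              }
            ; ∙-cong = λ {f} {f′} {g} {g′} p q x → trans (p (to g x)) (to-cong f′ (q x))
            }
          ; assoc = λ f g h x → refl
          }
        ; identity = (λ f x → refl) , (λ f x → refl)
        }
      ; inverse = (λ f x → strictlyInverseʳ f x) , (λ f x → strictlyInverseˡ f x)
      ; ⁻¹-cong = λ {f} {g} p x →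
          trans (from-cong f (trans (sym (strictlyInverseˡ g x))
                                    (sym (p (from g x)))))
                (strictlyInverseʳ f (from g x))
      }
    }
    where open Iso

  record PartialIso : Set ℓ where
    field
      dom cod : List Carrier
      iso     : Iso ⟪ dom ⟫ ⟪ cod ⟫
    open Iso iso public

  Graph : PartialIso → Carrier → Carrier → Set ℓ
  Graph p x y = ∃ λ (x∈ : x ∈ dom) → proj₁ (to (x , x∈)) ≡ y
    where open PartialIso p

  RestrictsIdentity : PartialIso → Set ℓ
  RestrictsIdentity p = ∀ x → proj₁ (PartialIso.to p x) ≡ proj₁ x

  record NontrivialPartialIso (C : Substructure) : Set ℓ where
    field
      partialIso : PartialIso
    open PartialIso partialIso public
    field
      dom⊆       : ⟪ dom ⟫ ⊆ C
      cod⊆       : ⟪ cod ⟫ ⊆ C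
      nontrivial : ¬ RestrictsIdentity partialIso

  -- The set 𝒫_C; partial isomorphisms are equal when they have the same graph.
  𝒫 : Substructure → Setoid ℓ ℓ
  𝒫 C = record
    { Carrier = NontrivialPartialIso C
    ; _≈_ = λ p q → ∀ x y → Graph (partialIso p) x y ⇔ Graph (partialIso q) x y
    ; isEquivalence = record
      { refl  = λ x y → mk⇔ (λ a → a) (λ a → a)
      ; sym   = λ p x y → Symm.equivalence (p x y)
      ; trans = λ p q x y → Comp.equivalence (p x y) (q x y)
      }
    }
    where open NontrivialPartialIso

  infix 10 _⁻¹ᴾ
  _⁻¹ᴾ : ∀ {C} → NontrivialPartialIso C → NontrivialPartialIso C
  p ⁻¹ᴾ = record
    { partialIso = record { dom = cod ; cod = dom ; iso = symIso iso }
    ; dom⊆       = cod⊆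
    ; cod⊆       = dom⊆
    ; nontrivial = λ triv → nontrivial λ x →
        trans (sym (triv (to x))) (strictlyInverseʳ x)
    }
    where open NontrivialPartialIso p

  𝒫-incl : ∀ {C₁ C₂} → C₁ ⊆ C₂ → NontrivialPartialIso C₁ → NontrivialPartialIso C₂
  𝒫-incl C₁⊆C₂ p = record
    { partialIso = partialIso
    ; dom⊆       = λ x∈ → C₁⊆C₂ (dom⊆ x∈)
    ; cod⊆       = λ x∈ → C₁⊆C₂ (cod⊆ x∈)
    ; nontrivial = nontrivial
    }
    where open NontrivialPartialIso p

  record HLExtension (C D : Substructure) : Set ℓ where
    open NontrivialPartialIso using (dom; to; dom⊆)
    private module A = Group (Aut D)
    field
      C⊆D : C ⊆ D
      φ   : Func (𝒫 C) A.setoid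
    -- φ p as an element of Aut D, and its action on D.
    ⟦_⟧ : NontrivialPartialIso C → Iso D D
    ⟦_⟧ = Func.to φ
    act : Iso D D → Σ Carrier D → Σ Carrier D
    act = Iso.to
    field
      extends  : ∀ p {x} (x∈ : x ∈ dom p) →
                 proj₁ (act ⟦ p ⟧ (x , C⊆D (dom⊆ p x∈))) ≡ proj₁ (to p (x , x∈))
      inverses : ∀ p → ⟦ p ⁻¹ᴾ ⟧ A.≈ ⟦ p ⟧ A.⁻¹

    word : List (NontrivialPartialIso C) → Iso D D
    word = foldr (λ p g → ⟦ p ⟧ A.∙ g) A.ε

    K : Group ℓ ℓ
    K = generatedSubgroup (Aut D) (λ g → ∃ λ p → ⟦ p ⟧ A.≈ g)

    generator : NontrivialPartialIso C → Group.Carrier K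
    generator p = ⟦ p ⟧ , gen (p , λ x → refl)

  Minimal : ∀ {C D} → HLExtension C D → Set ℓ
  Minimal {C} {D} H = ∀ b → D b → ¬ C b →
    ∃ λ ps → ∃ λ a → ∃ λ (a∈C : C a) → proj₁ (act (word ps) (a , C⊆D a∈C)) ≡ b
    where open HLExtension H

  record Coherent {C₁ C₂ D₁ D₂} (C₁⊆C₂ : C₁ ⊆ C₂)
                  (H₁ : HLExtension C₁ D₁) (H₂ : HLExtension C₂ D₂) : Set ℓ where
    private
      module H₁ = HLExtension H₁
      module H₂ = HLExtension H₂
      module K₁ = Group H₁.K
      module K₂ = Group H₂.K
    open GroupMorphisms K₁.rawGroup K₂.rawGroup using (IsGroupMonomorphism)
    field
      D₁⊆D₂     : D₁ ⊆ D₂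
      φ-extends : ∀ p {x} (x∈ : D₁ x) →
                  proj₁ (H₂.act H₂.⟦ 𝒫-incl C₁⊆C₂ p ⟧ (x , D₁⊆D₂ x∈)) ≡
                  proj₁ (H₁.act H₁.⟦ p ⟧ (x , x∈))
      embedding : ∃! (λ (h h′ : K₁.Carrier → K₂.Carrier) → ∀ g → h g K₂.≈ h′ g)
                     (λ h → IsGroupMonomorphism h ×
                            (∀ p → h (H₁.generator p) K₂.≈ H₂.generator (𝒫-incl C₁⊆C₂ p)))

  record Ultraextensive (U : Substructure) : Set ℓ where
    field
      ultrahomogeneous : HLExtension U U
      finiteExtension  : ∀ C → ⟪ C ⟫ ⊆ U →
        ∃ λ D → ⟪ D ⟫ ⊆ U × HLExtension ⟪ C ⟫ ⟪ D ⟫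
      coherentExtension : ∀ C₁ C₂ (C₁⊆C₂ : ⟪ C₁ ⟫ ⊆ ⟪ C₂ ⟫) → ⟪ C₂ ⟫ ⊆ U →
        ∀ D₁ → ⟪ D₁ ⟫ ⊆ U → (H₁ : HLExtension ⟪ C₁ ⟫ ⟪ D₁ ⟫) → Minimal H₁ →
        ∃ λ D₂ → ⟪ D₂ ⟫ ⊆ U × ∃ λ (H₂ : HLExtension ⟪ C₂ ⟫ ⟪ D₂ ⟫) →
          Minimal H₂ × Coherent C₁⊆C₂ H₁ H₂

{-# OPTIONS --safe #-}
-- D is the union of an increasing chain E₀ ⊆ E₁ ⊆ ⋯ of finite subsets of U. To
-- form Eₙ₊₁, add to Eₙ the element of C with code n, the images φ(p)(x) with
-- p ∈ 𝒫 Eₙ and x ∈ Eₙ (φ witnessing the ultrahomogeneity of U), and one solution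
-- D₂ for each coherent extension problem C₁ ⊆ C₂, (D₁ , φ₁) whose sets are lists
-- of length at most n over Eₙ. Up to pointwise equality 𝒫 Eₙ is finite, and so
-- are the maps φ₁ : 𝒫 C₁ → Aut D₁; hence finitely many elements are added.
module Submission where

open import Defs
open import Algebra.Bundles using (Group)
import Algebra.Morphism.Construct.Composition as MorphismComp
open import Algebra.Morphism.Structures using (module GroupMorphisms)
open import Axiom.ExcludedMiddle using (ExcludedMiddle)
open import Data.Bool using (Bool; true; false)
open import Data.Empty using (⊥; ⊥-elim)
open import Data.Fin using (Fin; funToFin; finToFun)
open import Data.Fin.Properties using (finToFun-funToFin)
open import Data.List
  using (List; []; _∷_; _++_; [_]; length; lookup; map; concatMap; fromMaybe;
         cartesianProduct; cartesianProductWith; allFin)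
open import Data.List.Membership.Propositional using (_∈_; find; lose; mapWith∈)
open import Data.List.Membership.Propositional.Properties
  using (∈-map⁺; ∈-++⁺ˡ; ∈-++⁺ʳ; ∈-++⁻; ∈-concatMap⁺; ∈-concatMap⁻; ∈-allFin;
         ∈-cartesianProduct⁺; ∈-cartesianProductWith⁺)
import Data.List.Membership.Setoid.Properties as SetoidMembership
open import Data.List.Properties using (++-assoc; ++-identityʳ)
open import Data.List.Relation.Unary.Any as Any using (here; there)
open import Data.List.Relation.Unary.Any.Properties using (lookup-index; mapWith∈⁺)
open import Data.List.Relation.Unary.Enumerates.Setoid using (IsEnumeration)
open import Data.List.Relation.Unary.Enumerates.Setoid.Properties using (cartesianProduct⁺)
open import Data.Nat using (ℕ; zero; suc; _≤_; _≤′_; ≤′-refl; ≤′-step; s≤s; _⊔_)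
open import Data.Nat.Properties using (m≤m⊔n; m≤n⊔m; ≤-trans; ≤⇒≤′; suc-injective)
open import Data.Product using (Σ; ∃; _×_; _,_; proj₁; proj₂; map₂)
open import Data.Product.Relation.Binary.Pointwise.NonDependent using (_×ₛ_)
open import Data.Sum using ([_,_]′)
import Data.Vec as Vec
open import Data.Vec.Properties using (map-∘)
open import Function using (_∘_)
open import Function.Bundles using (Func; Injection; _⇔_; mk⇔)
open import Relation.Binary.Bundles using (Setoid)
open import Relation.Binary.PropositionalEquality
  using (_≡_; refl; sym; trans; cong; cong₂; subst; subst₂; setoid)
open import Relation.Nullary using (yes; no; does)
open import Relation.Nullary.Decidable using (dec⇒maybe)
open import Relation.Unary using (_⊆_)

-- Lists of bounded length and finite setoids.

module _ {a} {A : Set a} where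

  -- Finite sets are presented by lists that may repeat elements, so even a finite set has
  -- infinitely many presentations; the length bound leaves finitely many to treat at each stage.
  listsUpTo : ℕ → List A → List (List A)
  listsUpTo zero    xs = [ [] ]
  listsUpTo (suc n) xs = [] ∷ cartesianProductWith _∷_ xs (listsUpTo n xs)

  ∈-listsUpTo⁺ : ∀ {n xs} ys → length ys ≤ n → (∀ {y} → y ∈ ys → y ∈ xs) → ys ∈ listsUpTo n xs
  ∈-listsUpTo⁺ {zero}  []       _        _     = here refl
  ∈-listsUpTo⁺ {suc n} []       _        _     = here refl
  ∈-listsUpTo⁺ {suc n} (y ∷ ys) (s≤s ≤n) ys⊆xs =
    there (∈-cartesianProductWith⁺ _∷_ (ys⊆xs (here refl)) (∈-listsUpTo⁺ ys ≤n (ys⊆xs ∘ there)))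

  ∈-concatMap : ∀ {b} {B : Set b} (f : B → List A) {x y xs} →
                x ∈ xs → y ∈ f x → y ∈ concatMap f xs
  ∈-concatMap f x∈ y∈ = ∈-concatMap⁺ f (lose x∈ y∈)

  elements : (xs : List A) → List (Σ A (_∈ xs))
  elements xs = mapWith∈ xs (_ ,_)

Finite : ∀ {a ℓ} → Setoid a ℓ → Set _
Finite S = ∃ (IsEnumeration S)

finite-Bool : Finite (setoid Bool)
finite-Bool = true ∷ false ∷ [] , λ where
  true  → here refl
  false → there (here refl)

finite-× : ∀ {a b ℓ₁ ℓ₂} {S : Setoid a ℓ₁} {T : Setoid b ℓ₂} →
           Finite S → Finite T → Finite (S ×ₛ T)
finite-× {S = S} {T} (xs , ∈xs) (ys , ∈ys) =
  cartesianProduct xs ys , cartesianProduct⁺ S T ∈xs ∈ys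

-- Choice and finiteness from excluded middle.

module Classical {ℓ} (em : ExcludedMiddle ℓ) where

  -- A choice operator: a list of at most one proof, chosen independently of any given one.
  chosen : (P : Set ℓ) → List P
  chosen P = fromMaybe (dec⇒maybe (em {P}))

  chosen⁺ : {P : Set ℓ} → P → ∃ (_∈ chosen P)
  chosen⁺ {P} p with em {P}
  ... | yes p′ = p′ , here refl
  ... | no ¬p  = ⊥-elim (¬p p)

  does-≡⇒→ : {P Q : Set ℓ} → does (em {P}) ≡ does (em {Q}) → P → Q
  does-≡⇒→ {P} {Q} eq p with em {P} | em {Q}
  ... | yes _ | yes q = q
  ... | no ¬p | _     = ⊥-elim (¬p p)
  does-≡⇒→ () p | yes _ | no _

  -- One element is chosen from each nonempty fibre of `code`; any element equals the one chosen
  -- from its own fibre. Equal elements may still receive different codes.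
  finite-code : ∀ {s} (S : Setoid ℓ s) {n} (code : Setoid.Carrier S → Fin n) →
                (∀ x y → code x ≡ code y → Setoid._≈_ S x y) → Finite S
  finite-code S {n} code code-injective =
    concatMap fibre (allFin n) , λ x →
      let ((y , y≡) , y∈) = chosen⁺ (x , refl)
      in Any.map (λ { refl → code-injective x y (sym y≡) })
           (∈-concatMap fibre (∈-allFin (code x)) (∈-map⁺ proj₁ y∈))
    where
    fibre : Fin n → List (Setoid.Carrier S)
    fibre i = map proj₁ (chosen (∃ λ x → code x ≡ i))

  module _ {a a′ b b′ s} (A : Setoid a a′) (B : Setoid b b′) (S : Setoid ℓ s) where

    private
      module A = Setoid A
      module B = Setoid B
      module S = Setoid S

    -- The code of `f` is its table of values on the enumeration of A, each value recorded as an
    -- index into the enumeration of B. Elements of S may carry proofs besides a function; `ext`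
    -- says that only the function counts.
    finite-functions : (app : S.Carrier → A.Carrier → B.Carrier) →
      (∀ f {x y} → x A.≈ y → app f x B.≈ app f y) →
      (∀ f g → (∀ x → app f x B.≈ app g x) → f S.≈ g) →
      Finite A → Finite B → Finite S
    finite-functions app app-cong ext (as , ∈as) (bs , ∈bs) =
      -- Equal codes give equal indices at the listed representative of `x`; `app-cong` carries the
      -- resulting equality of values back to `x`.
      finite-code S (funToFin ∘ values) λ f g eq → ext f g λ x →
        let i  = Any.index (∈as x)
            x≈ = lookup-index (∈as x)
            values≡ = trans (sym (finToFun-funToFin (values f) i))
                        (trans (cong (λ c → finToFun c i) eq) (finToFun-funToFin (values g) i))
        in B.trans (app-cong f x≈)
             (B.trans (SetoidMembership.index-injective B (∈bs _) (∈bs _) values≡)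
                      (B.sym (app-cong g x≈)))
      where
      values : S.Carrier → Fin (length as) → Fin (length bs)
      values f i = Any.index (∈bs (app f (lookup as i)))

-- Restricting automorphisms, and replacing an HL-extension by a pointwise equal one.

module _ {ℓ} {L : Language} (M : Structure L ℓ) where

  open Structure M

  -- Closure under the inverse is asked for separately, since an infinite D can be mapped by `f`
  -- properly into itself.
  restrictAut : ∀ {U D} (f : Iso M U U) (D⊆U : D ⊆ U) →
                (∀ {x} (x∈ : D x) → D (proj₁ (Iso.to f (x , D⊆U x∈)))) →
                (∀ {x} (x∈ : D x) → D (proj₁ (Iso.from f (x , D⊆U x∈)))) →
                Iso M D D
  restrictAut {U} {D} f D⊆U to∈ from∈ = record
    { bijection = record
      { to        = λ (_ , x∈) → _ , to∈ x∈
      ; from      = λ (_ , x∈) → _ , from∈ x∈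
      ; to-cong   = f.to-cong
      ; from-cong = f.from-cong
      ; inverse   = f.inverseˡ , f.inverseʳ
      }
    ; preserves = λ R v → subst₂ (λ u w → rel R u ⇔ rel R w)
        (sym (map-∘ proj₁ incl v)) (sym (map-∘ (proj₁ ∘ f.to) incl v))
        (f.preserves R (Vec.map incl v))
    }
    where
    module f = Iso f
    incl : Σ Carrier D → Σ Carrier U
    incl = map₂ D⊆U

  -- Equality compares only the automorphisms as maps on D. This is coarse enough for finitely many
  -- representatives and fine enough to preserve minimality and coherence.
  HLExtensions : Substructure M → Substructure M → Setoid ℓ ℓ
  HLExtensions C D = record
    { Carrier = HLExtension M C D
    ; _≈_ = λ H H′ → ∀ p → Group._≈_ (Aut M D) (HLExtension.⟦_⟧ H p) (HLExtension.⟦_⟧ H′ p)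
    ; isEquivalence = record
      { refl  = λ _ _ → refl
      ; sym   = λ eq p x → sym (eq p x)
      ; trans = λ eq eq′ p x → trans (eq p x) (eq′ p x)
      }
    }

  module _ {C D : Substructure M} (H H′ : HLExtension M C D)
           (H≈H′ : Setoid._≈_ (HLExtensions C D) H H′) where

    private
      module H  = HLExtension H
      module H′ = HLExtension H′

    word-≈ : ∀ ps x → proj₁ (H.act (H.word ps) x) ≡ proj₁ (H′.act (H′.word ps) x)
    word-≈ []       x = refl
    word-≈ (p ∷ ps) x =
      trans (Iso.to-cong H.⟦ p ⟧ (word-≈ ps x)) (H≈H′ p (H′.act (H′.word ps) x))

    Minimal-≈ : Minimal M H → Minimal M H′
    Minimal-≈ minimal b b∈D b∉C =
      let ps , a , a∈C , eq = minimal b b∈D b∉C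
      in ps , a , a∈C ,
         -- `H` and `H′` may place `a` in D by different membership proofs; `to-cong` at `refl`
         -- bridges them.
         trans (sym (word-≈ ps _)) (trans (Iso.to-cong (H.word ps) refl) eq)

    -- Both groups consist of the same automorphisms of D, so the map is the identity on these and
    -- only rewrites the derivation of membership.
    K-≈ : Group.Carrier H.K → Group.Carrier H′.K
    K-≈ (g , g∈) = g , convert g∈
      where
      convert : ∀ {g} → Generated (Aut M D) (λ g → ∃ λ p → Group._≈_ (Aut M D) H.⟦ p ⟧ g) g →
                Generated (Aut M D) (λ g → ∃ λ p → Group._≈_ (Aut M D) H′.⟦ p ⟧ g) g
      convert (gen (p , eq)) = gen (p , λ x → trans (sym (H≈H′ p x)) (eq x))
      convert unit           = unit
      convert (mul g∈ h∈)    = mul (convert g∈) (convert h∈)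
      convert (inv g∈)       = inv (convert g∈)
      convert (resp eq g∈)   = resp eq (convert g∈)

    open GroupMorphisms (Group.rawGroup H.K) (Group.rawGroup H′.K) using (IsGroupMonomorphism)

    K-≈-isGroupMonomorphism : IsGroupMonomorphism K-≈
    K-≈-isGroupMonomorphism = record
      { isGroupHomomorphism = record
        { isMonoidHomomorphism = record
          { isMagmaHomomorphism = record
            { isRelHomomorphism = record { cong = λ eq → eq }
            ; homo = λ _ _ _ → refl
            }
          ; ε-homo = λ _ → refl
          }
        ; ⁻¹-homo = λ _ _ → refl
        }
      ; injective = λ eq → eq
      }

  -- The embedding is transported along the identification of the two groups K₁. The inclusion proof
  -- may change too, because a chosen solution comes with its own.
  Coherent-≈ : ∀ {C₁ C₂ D₁ D₂ : Substructure M} {C₁⊆C₂ C₁⊆C₂′ : C₁ ⊆ C₂}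
    (H₁ H₁′ : HLExtension M C₁ D₁) (H₂ : HLExtension M C₂ D₂) →
    Setoid._≈_ (HLExtensions C₁ D₁) H₁ H₁′ →
    Coherent M C₁⊆C₂ H₁ H₂ → Coherent M C₁⊆C₂′ H₁′ H₂
  Coherent-≈ {C₁} {C₂} {D₁} {D₂} {C₁⊆C₂} {C₁⊆C₂′} H₁ H₁′ H₂ H₁≈H₁′ coherent = record
    { D₁⊆D₂     = coherent.D₁⊆D₂
    ; φ-extends = λ p x∈ →
        trans (incl-≈ p _) (trans (coherent.φ-extends p x∈) (H₁≈H₁′ p _))
    ; embedding =
        (λ g → h (back g)) ,
        (MorphismComp.isGroupMonomorphism (λ {f} {g} {k} → K₂-trans {f} {g} {k})
           (K-≈-isGroupMonomorphism H₁′ H₁ H₁′≈H₁) h-mono ,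
         λ p x → trans (h-cong (H₁′≈H₁ p) x)
                       (trans (h-gen p x) (sym (incl-≈ p x)))) ,
        -- A competitor `k` on the new group, precomposed with `forth`, competes with `h` on the old
        -- one, where uniqueness applies.
        λ {k} (k-mono , k-gen) g →
          K₂-trans {h (back g)} {k (forth (back g))} {k g}
            (unique {k ∘ forth}
              ( MorphismComp.isGroupMonomorphism (λ {f} {g} {k} → K₂-trans {f} {g} {k})
                  (K-≈-isGroupMonomorphism H₁ H₁′ H₁≈H₁′) k-mono
              , λ p x → trans (GroupMorphisms.IsGroupMonomorphism.⟦⟧-cong k-mono (H₁≈H₁′ p) x)
                              (trans (k-gen p x) (incl-≈ p x)))
              (back g))
            (GroupMorphisms.IsGroupMonomorphism.⟦⟧-cong k-mono (λ _ → refl))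
    }
    where
    module coherent = Coherent coherent
    module H₂ = HLExtension H₂
    K₂-trans = λ {f} {g} {k} → Group.trans H₂.K {f} {g} {k}
    H₁′≈H₁ = Setoid.sym (HLExtensions C₁ D₁) {H₁} {H₁′} H₁≈H₁′
    incl-≈ : ∀ p → Group._≈_ (Aut M D₂) H₂.⟦ 𝒫-incl M C₁⊆C₂′ p ⟧ H₂.⟦ 𝒫-incl M C₁⊆C₂ p ⟧
    -- The two inclusions of `p` have the same graph, and `φ` respects equality of graphs.
    incl-≈ p = Func.cong H₂.φ λ x y → mk⇔ (λ a → a) (λ a → a)
    back  = K-≈ H₁′ H₁ H₁′≈H₁
    forth = K-≈ H₁ H₁′ H₁≈H₁′
    h      = proj₁ coherent.embedding
    h-mono = proj₁ (proj₁ (proj₂ coherent.embedding))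
    h-gen  = proj₂ (proj₁ (proj₂ coherent.embedding))
    unique = proj₂ (proj₂ coherent.embedding)
    h-cong = GroupMorphisms.IsGroupMonomorphism.⟦⟧-cong h-mono

-- Finiteness of the data over finite sets, and positions in lists.

module _ {ℓ} (em : ExcludedMiddle ℓ) {L : Language} (M : Structure L ℓ) where

  open Classical em
  open Structure M

  finite-⟪⟫ : ∀ xs → Finite (Elements M (⟪_⟫ M xs))
  finite-⟪⟫ xs = elements xs , λ (x , x∈) → mapWith∈⁺ (_ ,_) (x , x∈ , refl)

  -- Only the existence of these enumerations matters; unfolding them is very slow.
  abstract

    -- A partial isomorphism is determined by its graph, here a Boolean table on pairs from `xs`.
    finite-𝒫 : ∀ xs → Finite (𝒫 M (⟪_⟫ M xs))
    finite-𝒫 xs = finite-functions (E ×ₛ E) (setoid Bool) (𝒫 M (⟪_⟫ M xs))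
      (λ p (u , v) → graph p (proj₁ u) (proj₁ v))
      (λ p (x≡ , y≡) → cong₂ (graph p) x≡ y≡)
      (λ p q eq x y → mk⇔ (graph⊆ p q eq) (graph⊆ q p (sym ∘ eq)))
      (finite-× {S = E} {E} (finite-⟪⟫ xs) (finite-⟪⟫ xs)) finite-Bool
      where
      open NontrivialPartialIso using (partialIso; dom⊆; cod⊆)
      E : Setoid ℓ ℓ
      E = Elements M (⟪_⟫ M xs)
      graph : NontrivialPartialIso M (⟪_⟫ M xs) → Carrier → Carrier → Bool
      graph p x y = does (em {Graph M (partialIso p) x y})
      graph⊆ : ∀ p q →
        (∀ (uv : Σ Carrier (_∈ xs) × Σ Carrier (_∈ xs)) →
           graph p (proj₁ (proj₁ uv)) (proj₁ (proj₂ uv)) ≡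
           graph q (proj₁ (proj₁ uv)) (proj₁ (proj₂ uv))) →
        ∀ {x y} → Graph M (partialIso p) x y → Graph M (partialIso q) x y
      -- Domain and codomain of `p` lie in `xs`, so every pair of its graph occurs in the table.
      graph⊆ p q eq {x} (x∈ , refl) =
        does-≡⇒→ (eq ((x , dom⊆ p x∈) , (_ , cod⊆ p (proj₂ (NontrivialPartialIso.to p (x , x∈))))))
                 (x∈ , refl)

    finite-Aut : ∀ xs → Finite (Group.setoid (Aut M (⟪_⟫ M xs)))
    finite-Aut xs = finite-functions E E (Group.setoid (Aut M (⟪_⟫ M xs)))
      Iso.to (λ f → Iso.to-cong f) (λ f g eq → eq) (finite-⟪⟫ xs) (finite-⟪⟫ xs)
      where
      E : Setoid ℓ ℓ
      E = Elements M (⟪_⟫ M xs)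

    finite-HLExtensions : ∀ xs ys → Finite (HLExtensions M (⟪_⟫ M xs) (⟪_⟫ M ys))
    finite-HLExtensions xs ys =
      finite-functions (𝒫 M (⟪_⟫ M xs)) (Group.setoid (Aut M (⟪_⟫ M ys)))
        (HLExtensions M (⟪_⟫ M xs) (⟪_⟫ M ys))
        HLExtension.⟦_⟧ (λ H → Func.cong (HLExtension.φ H)) (λ H H′ eq → eq)
        (finite-𝒫 xs) (finite-Aut ys)

  -- The first occurrence is taken so that appending elements leaves the position of a member
  -- unchanged. An absent element gets the length of the list.
  position : Carrier → List Carrier → ℕ
  position x []       = zero
  position x (y ∷ ys) with em {x ≡ y}
  ... | yes _ = zero
  ... | no  _ = suc (position x ys)

  position-++ : ∀ {x} xs {ys} → x ∈ xs → position x (xs ++ ys) ≡ position x xs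
  position-++ {x} (y ∷ xs) x∈ with em {x ≡ y} | x∈
  ... | yes _  | _        = refl
  ... | no x≢y | here x≡y = ⊥-elim (x≢y x≡y)
  ... | no _   | there x∈ = cong suc (position-++ xs x∈)

  position-injective : ∀ {x y} xs → x ∈ xs → y ∈ xs → position x xs ≡ position y xs → x ≡ y
  position-injective {x} {y} (z ∷ xs) x∈ y∈ eq with em {x ≡ z} | em {y ≡ z} | x∈ | y∈
  ... | yes x≡z | yes y≡z | _        | _        = trans x≡z (sym y≡z)
  ... | no x≢z  | _       | here x≡z | _        = ⊥-elim (x≢z x≡z)
  ... | _       | no y≢z  | _        | here y≡z = ⊥-elim (y≢z y≡z)
  ... | no _    | no _    | there x∈ | there y∈ =
    position-injective xs x∈ y∈ (suc-injective eq)
  position-injective (z ∷ xs) x∈ y∈ () | yes _ | no _ | _ | there _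
  position-injective (z ∷ xs) x∈ y∈ () | no _ | yes _ | there _ | _

  -- The chain of finite sets and its countable union.

  module Closure {U : Substructure M} (ultra : Ultraextensive M U)
                 {C : Substructure M} (C⊆U : C ⊆ U) (C-countable : Countable M C) where

    open Ultraextensive ultra
    open NontrivialPartialIso using (dom; cod; dom⊆; cod⊆)

    private
      module U = HLExtension ultrahomogeneous
      module C = Injection C-countable

    FiniteSubset : Set ℓ
    FiniteSubset = ∃ λ xs → ⟪_⟫ M xs ⊆ U

    ⋃ : List FiniteSubset → FiniteSubset
    ⋃ Xs = concatMap proj₁ Xs , λ x∈ →
      let (_ , X⊆U) , _ , x∈X = find (∈-concatMap⁻ proj₁ {xs = Xs} x∈) in X⊆U x∈X

    _∪_ : FiniteSubset → FiniteSubset → FiniteSubset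
    (xs , xs⊆U) ∪ (ys , ys⊆U) = xs ++ ys , [ xs⊆U , ys⊆U ]′ ∘ ∈-++⁻ xs

    singleton : ∃ U → FiniteSubset
    singleton (x , x∈U) = [ x ] , λ { (here refl) → x∈U }

    enumerated : ℕ → List FiniteSubset
    enumerated n = map (λ ((x , x∈C) , _) → singleton (x , C⊆U x∈C))
                       (chosen (∃ λ x → C.to x ≡ n))

    images : FiniteSubset → List FiniteSubset
    images (xs , xs⊆U) =
      concatMap (λ p → map (λ x → singleton (U.act U.⟦ 𝒫-incl M xs⊆U p ⟧ (map₂ xs⊆U x))) (elements xs))
                (proj₁ (finite-𝒫 xs))

    HL : (Xs Ys : List Carrier) → Setoid ℓ ℓ
    HL Xs Ys = HLExtensions M (⟪_⟫ M Xs) (⟪_⟫ M Ys)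

    -- All hypotheses of the coherent extension property form one proposition, so that `chosen`
    -- fixes their proofs and hence a single solution for each C₁, C₂, D₁ and H₁.
    record Solvable (C₁ C₂ D₁ : List Carrier) (H₁ : Setoid.Carrier (HL C₁ D₁)) : Set ℓ where
      field
        C₁⊆C₂   : ⟪_⟫ M C₁ ⊆ ⟪_⟫ M C₂
        C₂⊆U    : ⟪_⟫ M C₂ ⊆ U
        D₁⊆U    : ⟪_⟫ M D₁ ⊆ U
        minimal : Minimal M H₁

      solved = coherentExtension C₁ C₂ C₁⊆C₂ C₂⊆U D₁ D₁⊆U H₁ minimal

      solution : FiniteSubset
      solution = proj₁ solved , proj₁ (proj₂ solved)

    solutionsFor : List Carrier × List Carrier × List Carrier → List FiniteSubset
    solutionsFor (C₁ , C₂ , D₁) =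
      concatMap (λ H₁ → map Solvable.solution (chosen (Solvable C₁ C₂ D₁ H₁)))
                (proj₁ (finite-HLExtensions C₁ D₁))

    solutions : ℕ → List Carrier → List FiniteSubset
    solutions n xs = concatMap solutionsFor (cartesianProduct ls (cartesianProduct ls ls))
      where ls = listsUpTo n xs

    added : ℕ → FiniteSubset → List FiniteSubset
    added n X = enumerated n ++ (images X ++ solutions n (proj₁ X))

    stage : ℕ → FiniteSubset
    stage zero    = [] , λ ()
    stage (suc n) = stage n ∪ ⋃ (added n (stage n))

    E : ℕ → List Carrier
    E n = proj₁ (stage n)

    E⊆U : ∀ n → ⟪_⟫ M (E n) ⊆ U
    E⊆U n = proj₂ (stage n)

    D : Substructure M
    D x = ∃ λ n → x ∈ E n

    D⊆U : D ⊆ U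
    D⊆U (n , x∈) = E⊆U n x∈

    added⊆D : ∀ n {X} → X ∈ added n (stage n) → ⟪_⟫ M (proj₁ X) ⊆ D
    added⊆D n X∈ x∈ = suc n , ∈-++⁺ʳ (E n) (∈-concatMap proj₁ X∈ x∈)

    -- New elements are appended at the end, so later stages preserve positions; plain inclusion
    -- would not give the numbering of `D`.
    E-prefix : ∀ {m n} → m ≤ n → ∃ λ ys → E n ≡ E m ++ ys
    E-prefix = go ∘ ≤⇒≤′
      where
      go : ∀ {m n} → m ≤′ n → ∃ λ ys → E n ≡ E m ++ ys
      go ≤′-refl = [] , sym (++-identityʳ _)
      go {m} (≤′-step {n = n} m≤n) =
        let ys , eq = go m≤n
            zs = proj₁ (⋃ (added n (stage n)))
        in ys ++ zs , trans (cong (_++ zs) eq) (++-assoc (E m) ys zs)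

    E-mono : ∀ {m n} → m ≤ n → ⟪_⟫ M (E m) ⊆ ⟪_⟫ M (E n)
    E-mono m≤n {x} x∈ = let ys , eq = E-prefix m≤n in subst (x ∈_) (sym eq) (∈-++⁺ˡ x∈)

    finite⊆E : ∀ xs → ⟪_⟫ M xs ⊆ D → ∃ λ n → ⟪_⟫ M xs ⊆ ⟪_⟫ M (E n)
    finite⊆E []       xs⊆D = zero , λ ()
    finite⊆E (x ∷ xs) xs⊆D =
      let m , x∈ = xs⊆D (here refl)
          n , xs⊆ = finite⊆E xs (xs⊆D ∘ there)
      in m ⊔ n , λ where
           (here refl) → E-mono (m≤m⊔n m n) x∈
           (there y∈)  → E-mono (m≤n⊔m m n) (xs⊆ y∈)

    C⊆D : C ⊆ D
    C⊆D {x} x∈C =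
      let c = x , x∈C
          -- The element added at this stage is the chosen one with the code of `x`; injectivity of
          -- the code identifies it with `x`.
          (_ , eq) , c′∈ = chosen⁺ {∃ λ y → C.to y ≡ C.to c} (c , refl)
      in added⊆D (C.to c) (∈-++⁺ˡ (∈-map⁺ _ c′∈)) (here (sym (C.injective eq)))

    D-countable : Countable M D
    D-countable = record
      { to        = λ (x , n , _) → position x (E n)
      -- Positions at stages m and n both agree with the position at stage m ⊔ n.
      ; cong      = λ { {x , m , x∈m} {_ , n , x∈n} refl →
          trans (sym (position-E (m≤m⊔n m n) x∈m)) (position-E (m≤n⊔m m n) x∈n) }
      ; injective = λ { {x , m , x∈} {y , n , y∈} eq →
          position-injective (E (m ⊔ n)) (E-mono (m≤m⊔n m n) x∈) (E-mono (m≤n⊔m m n) y∈)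
            (trans (position-E (m≤m⊔n m n) x∈) (trans eq (sym (position-E (m≤n⊔m m n) y∈)))) }
      }
      where
      position-E : ∀ {m n x} → m ≤ n → x ∈ E m → position x (E n) ≡ position x (E m)
      position-E {m} {n} {x} m≤n x∈ =
        let ys , eq = E-prefix m≤n
        in trans (cong (position x) eq) (position-++ (E m) x∈)

    -- Ultrahomogeneity of the union.

    ⟦_⟧ᵁ : NontrivialPartialIso M D → Iso M U U
    ⟦ p ⟧ᵁ = U.⟦ 𝒫-incl M D⊆U p ⟧

    -- Only images under listed representatives were added, but `p` has the graph of some
    -- representative `r`, and `φ` gives both the same automorphism.
    images-added : ∀ n (p : NontrivialPartialIso M (⟪_⟫ M (E n))) {x} (x∈ : x ∈ E n) →
                   D (proj₁ (U.act U.⟦ 𝒫-incl M (E⊆U n) p ⟧ (x , E⊆U n x∈)))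
    images-added n p {x} x∈
      with r , r∈ , p≈r ← find (proj₂ (finite-𝒫 (E n)) p)
         | y , y∈ , x≡y ← find (proj₂ (finite-⟪⟫ (E n)) (x , x∈)) =
      added⊆D n
        (∈-++⁺ʳ (enumerated n) (∈-++⁺ˡ (∈-concatMap _ r∈ (∈-map⁺ _ y∈))))
        (here (trans (Func.cong U.φ p≈r _) (Iso.to-cong U.⟦ 𝒫-incl M (E⊆U n) r ⟧ x≡y)))

    -- Some stage contains `x` together with the finite domain and codomain of `p`; the next stage
    -- receives the image.
    images⊆D : ∀ p {x} (x∈ : D x) → D (proj₁ (U.act ⟦ p ⟧ᵁ (x , D⊆U x∈)))
    images⊆D p {x} (k , x∈)
      with l , dom⊆E ← finite⊆E (dom p) (dom⊆ p) | m , cod⊆E ← finite⊆E (cod p) (cod⊆ p) =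
      subst D (trans (Func.cong U.φ (λ _ _ → mk⇔ (λ a → a) (λ a → a)) _)
                     (Iso.to-cong ⟦ p ⟧ᵁ refl))
              (images-added n q (E-mono {k} {n} (m≤m⊔n k _) x∈))
      where
      n = k ⊔ (l ⊔ m)
      q : NontrivialPartialIso M (⟪_⟫ M (E n))
      q = record
        { partialIso = NontrivialPartialIso.partialIso p
        ; dom⊆       = λ y∈ → E-mono {l} {n} (≤-trans (m≤m⊔n l m) (m≤n⊔m k _)) (dom⊆E y∈)
        ; cod⊆       = λ y∈ → E-mono {m} {n} (≤-trans (m≤n⊔m l m) (m≤n⊔m k _)) (cod⊆E y∈)
        ; nontrivial = NontrivialPartialIso.nontrivial p
        }

    D-ultrahomogeneous : HLExtension M D D
    D-ultrahomogeneous = record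
      { C⊆D      = λ x∈ → x∈
      ; φ        = record
        { to   = λ p → restrictAut M ⟦ p ⟧ᵁ D⊆U (images⊆D p) λ x∈ →
            -- Closure under the inverse automorphism is closure under the one assigned to the
            -- inverse of `p`.
            subst D (U.inverses (𝒫-incl M D⊆U p) _) (images⊆D (_⁻¹ᴾ M p) x∈)
        ; cong = λ p≈q x → Func.cong U.φ p≈q _
        }
      ; extends  = λ p x∈ →
          trans (Iso.to-cong ⟦ p ⟧ᵁ refl) (U.extends (𝒫-incl M D⊆U p) x∈)
      ; inverses = λ p x → U.inverses (𝒫-incl M D⊆U p) _
      }

    -- Finite and coherent extensions inside the union.

    solution-added : ∀ n {C₁ C₂ D₁ H₁} →
      C₁ ∈ listsUpTo n (E n) → C₂ ∈ listsUpTo n (E n) → D₁ ∈ listsUpTo n (E n) →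
      H₁ ∈ proj₁ (finite-HLExtensions C₁ D₁) →
      ∀ {s} → s ∈ chosen (Solvable C₁ C₂ D₁ H₁) → ⟪_⟫ M (proj₁ (Solvable.solution s)) ⊆ D
    solution-added n {C₁} {C₂} {D₁} {H₁} C₁∈ C₂∈ D₁∈ H₁∈ s∈ =
      added⊆D n (∈-++⁺ʳ (enumerated n) (∈-++⁺ʳ (images (stage n))
        (∈-concatMap solutionsFor (∈-cartesianProduct⁺ C₁∈ (∈-cartesianProduct⁺ C₂∈ D₁∈))
          (∈-concatMap (λ H₁ → map Solvable.solution (chosen (Solvable C₁ C₂ D₁ H₁)))
             H₁∈ (∈-map⁺ Solvable.solution s∈)))))

    CoherentSolution : ∀ C₁ C₂ D₁ → ⟪_⟫ M C₁ ⊆ ⟪_⟫ M C₂ → HLExtension M (⟪_⟫ M C₁) (⟪_⟫ M D₁) → Set ℓ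
    CoherentSolution C₁ C₂ D₁ C₁⊆C₂ H₁ =
      ∃ λ D₂ → ⟪_⟫ M D₂ ⊆ D × ∃ λ (H₂ : HLExtension M (⟪_⟫ M C₂) (⟪_⟫ M D₂)) →
        Minimal M H₂ × Coherent M C₁⊆C₂ H₁ H₂

    -- The problem is passed to the listed representative H₁′ of H₁, whose chosen solution was added
    -- after stage n, and coherence is carried back to H₁.
    solve : ∀ n {C₁ C₂ D₁} (C₁⊆C₂ : ⟪_⟫ M C₁ ⊆ ⟪_⟫ M C₂) H₁ → Minimal M H₁ →
      ⟪_⟫ M C₂ ⊆ U → ⟪_⟫ M D₁ ⊆ U →
      C₁ ∈ listsUpTo n (E n) → C₂ ∈ listsUpTo n (E n) → D₁ ∈ listsUpTo n (E n) →
      CoherentSolution C₁ C₂ D₁ C₁⊆C₂ H₁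
    solve n {C₁} {C₂} {D₁} C₁⊆C₂ H₁ minimal C₂⊆U D₁⊆U C₁∈ C₂∈ D₁∈
      with H₁′ , H₁′∈ , H₁≈H₁′ ← find (proj₂ (finite-HLExtensions C₁ D₁) H₁)
      with s , s∈ ← chosen⁺ {Solvable C₁ C₂ D₁ H₁′} (record
             { C₁⊆C₂ = C₁⊆C₂ ; C₂⊆U = C₂⊆U ; D₁⊆U = D₁⊆U
             ; minimal = Minimal-≈ M H₁ H₁′ H₁≈H₁′ minimal }) =
      let D₂ , _ , H₂ , minimal₂ , coherent = Solvable.solved s
      in D₂ , solution-added n C₁∈ C₂∈ D₁∈ H₁′∈ s∈ , H₂ , minimal₂ ,
         Coherent-≈ M H₁′ H₁ H₂ (Setoid.sym (HL C₁ D₁) {H₁} {H₁′} H₁≈H₁′) coherent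

    D-coherentExtension : ∀ C₁ C₂ (C₁⊆C₂ : ⟪_⟫ M C₁ ⊆ ⟪_⟫ M C₂) → ⟪_⟫ M C₂ ⊆ D →
      ∀ D₁ → ⟪_⟫ M D₁ ⊆ D → ∀ H₁ → Minimal M H₁ → CoherentSolution C₁ C₂ D₁ C₁⊆C₂ H₁
    D-coherentExtension C₁ C₂ C₁⊆C₂ C₂⊆D D₁ D₁⊆D H₁ minimal
      with k , C₂⊆E ← finite⊆E C₂ C₂⊆D | l , D₁⊆E ← finite⊆E D₁ D₁⊆D =
      solve n C₁⊆C₂ H₁ minimal (D⊆U ∘ C₂⊆D) (D⊆U ∘ D₁⊆D)
        (∈-listsUpTo⁺ C₁ (≤-trans (m≤m⊔n n₁ _) lengths≤n) (C₂⊆ ∘ C₁⊆C₂))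
        (∈-listsUpTo⁺ C₂ (≤-trans (m≤m⊔n n₂ n₃) (≤-trans (m≤n⊔m n₁ _) lengths≤n)) C₂⊆)
        (∈-listsUpTo⁺ D₁ (≤-trans (m≤n⊔m n₂ n₃) (≤-trans (m≤n⊔m n₁ _) lengths≤n))
          λ x∈ → E-mono {l} {n} (≤-trans (m≤m⊔n l _) (m≤n⊔m k _)) (D₁⊆E x∈))
      where
      n₁ = length C₁
      n₂ = length C₂
      n₃ = length D₁
      -- The index serves twice: stage n contains C₂ and D₁, hence C₁, and n bounds the lengths of
      -- all three lists.
      n = k ⊔ (l ⊔ (n₁ ⊔ (n₂ ⊔ n₃)))
      lengths≤n : n₁ ⊔ (n₂ ⊔ n₃) ≤ n
      lengths≤n = ≤-trans (m≤n⊔m l _) (m≤n⊔m k _)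
      C₂⊆ : ⟪_⟫ M C₂ ⊆ ⟪_⟫ M (E n)
      C₂⊆ x∈ = E-mono {k} {n} (m≤m⊔n k _) (C₂⊆E x∈)

    -- The empty structure serves as base, so that finite extensions become a special case of
    -- coherent ones.
    trivialHLExtension : HLExtension M (⟪_⟫ M []) (⟪_⟫ M [])
    trivialHLExtension = record
      { C⊆D      = λ x∈ → x∈
      ; φ        = record { to = λ _ → idIso M _ ; cong = λ _ _ → refl }
      ; extends  = λ p x∈ → ⊥-elim (∉[] (dom⊆ p x∈))
      ; inverses = λ _ _ → refl
      }
      where
      ∉[] : ∀ {x : Carrier} → x ∈ [] → ⊥
      ∉[] ()

    D-ultraextensive : Ultraextensive M D
    D-ultraextensive = record
      { ultrahomogeneous  = D-ultrahomogeneous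
      ; finiteExtension   = λ X X⊆D →
          let Y , Y⊆D , H , _ =
                -- Minimality is vacuous, as the extension of the empty set is empty.
                D-coherentExtension [] X (λ ()) X⊆D [] (λ ()) trivialHLExtension (λ _ ())
          in Y , Y⊆D , H
      ; coherentExtension = D-coherentExtension
      }

theorem1p5 : ∀ {ℓ} → ExcludedMiddle ℓ →
    (L : Language) (M : Structure L ℓ) (U : Substructure M) → Ultraextensive M U →
    (C : Substructure M) → C ⊆ U → Countable M C →
    ∃ λ (D : Substructure M) →
    C ⊆ D × D ⊆ U × Countable M D × Ultraextensive M D
theorem1p5 em L M U ultra C C⊆U C-countable =
  D , C⊆D , D⊆U , D-countable , D-ultraextensive
  where open Closure em M ultra C⊆U C-countable
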